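{- Let $m,n\ge 1$ be integers, $a>0$ and $q>0$, and consider the directed grid $G_{m,n}$ with source $s=(0,0)$, sink $t=(m,n)$ and demand $q$. For a chord $u\to v$ and $b,c,d\ge0$, let $BR(u\to v;b,c,d)$ be the Braess Ratio when every grid edge has latency $ax+b$ and the chord has latency $cx+d$. Suppose the grid is capable of Braess' Paradox, i.e. $BR(u\to v;b,c,d)>1$ for some chord $u\to v$ and some $b,c,d\ge0$. If a chord $u\to v$ with coefficients $b,c,d\ge 0$ maximizes the Braess Ratio over all chords and all nonnegative coefficients, then the chord has zero latency, that is, \[ c=d=0 . \]
   Context: Grid: $G_{m,n}=(V,E)$ is the directed graph with vertex set $V=\{0,\dots,m\}\times\{0,\dots,n\}$ and directed edges $(i,j)\to(i+1,j)$ for $i<m$ and $(i,j)\to(i,j+1)$ for $j<n$. Chord: an added directed edge $u\to v$ with $u,v\in V$, $u\ne v$, such that $uv$ is not an edge of the underlying undirected grid. Feasible flow (in the grid, or in the grid plus chord): a nonnegative number $f_e$ for each directed edge $e$, with flow conserved at every vertex other than $s,t$, and net outflow from $s$ and net inflow to $t$ both equal to $q$. Its cost is $C(f)=\sum_e f_e\ell_e(f_e)$, where $\ell_e$ is the latency function of $e$. User Equilibrium: a feasible flow, decomposable into flows along $s$-$t$ paths, such that every path carrying positive flow has latency (sum of $\ell_e(f_e)$ over its edges) no larger than that of any other $s$-$t$ path. By a classical theorem (Beckmann, McGuire, Winsten) these are exactly the minimizers over feasible flows of the Beckmann potential $Z(f)=\sum_e\int_0^{f_e}\ell_e(y)\,dy$;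 in the networks considered here the minimizer is unique. Braess Ratio: $BR=C_{\mathrm{new}}/C_{\mathrm{old}}$, where $C_{\mathrm{old}}$ is the cost of the User Equilibrium of $G_{m,n}$ and $C_{\mathrm{new}}$ is the cost of the User Equilibrium of $G_{m,n}$ with the chord added (same $s,t,q$). Braess' Paradox means $BR>1$. -}

module Defs where

open import Level using (0ℓ; suc)
open import Algebra.Bundles using (CommutativeRing)
open import Data.Fin using (Fin; fromℕ; inject₁) renaming (zero to fzero; suc to fsuc)
import Data.Fin.Properties as Fin
open import Data.List using (List; []; _∷_; _++_; map; foldr; filter; allFin; cartesianProduct)
open import Data.List.Membership.Propositional using (_∈_)
import Data.List.Membership.DecPropositional as DecMembership
open import Data.List.Relation.Unary.All using (All)
open import Data.List.Relation.Unary.Unique.Propositional using (Unique)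
open import Data.Maybe using (Maybe; just; nothing; maybe)
import Data.Maybe.Properties as Maybe
open import Data.Nat as ℕ using (ℕ)
open import Data.Product using (∃; ∃-syntax; _×_; _,_; proj₁; proj₂)
import Data.Product.Properties as Product
open import Data.Sum using (_⊎_; inj₁; inj₂)
import Data.Sum.Properties as Sum
open import Relation.Binary.Core using (Rel)
open import Relation.Binary.Definitions using (DecidableEquality)
open import Relation.Binary.PropositionalEquality using (_≡_; _≢_)
open import Relation.Binary.Structures using (IsDecTotalOrder)
open import Relation.Nullary using (¬_)
open import Relation.Unary using (Pred; Satisfiable)
import Relation.Binary.Construct.NonStrictToStrict as Strict

-- The real numbers, given by their axioms as a complete ordered field.  The
-- order is decidable and suprema exist for arbitrary predicates, i.e. these are
-- the classical reals; equality is a setoid equality, so that representations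
-- by Cauchy sequences or Dedekind cuts are covered.
record RealNumbers : Set (suc 0ℓ) where
  infix 4 _≤_
  field
    commutativeRing : CommutativeRing 0ℓ 0ℓ

  open CommutativeRing commutativeRing public

  field
    _≤_             : Rel Carrier 0ℓ
    isDecTotalOrder : IsDecTotalOrder _≈_ _≤_
    0≉1             : ¬ (0# ≈ 1#)
    inverse         : ∀ x → ¬ (x ≈ 0#) → ∃[ y ] (x * y ≈ 1#)
    +-monoʳ-≤       : ∀ z {x y} → x ≤ y → z + x ≤ z + y
    *-nonNegative   : ∀ {x y} → 0# ≤ x → 0# ≤ y → 0# ≤ x * y

  open Strict _≈_ _≤_ public using (_<_)

  UpperBound : Pred Carrier 0ℓ → Pred Carrier 0ℓ
  UpperBound P z = ∀ x → P x → x ≤ z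

  field
    supremum : (P : Pred Carrier 0ℓ) → Satisfiable P → Satisfiable (UpperBound P) →
               ∃[ z ] (UpperBound P z × (∀ y → UpperBound P y → z ≤ y))

  ∑ : ∀ {A : Set} → List A → (A → Carrier) → Carrier
  ∑ xs f = foldr (λ x acc → f x + acc) 0# xs

-- A finite directed graph; `edges` lists every element of E exactly once.
record Digraph : Set (suc 0ℓ) where
  field
    V E     : Set
    src tgt : E → V
    edges   : List E
    _≟ᵛ_    : DecidableEquality V
    _≟ᵉ_    : DecidableEquality E

module _ (G : Digraph) where
  open Digraph G

  Connects : V → List E → V → Set
  Connects u []       w = u ≡ w
  Connects u (e ∷ es) w = src e ≡ u × Connects (tgt e) es w

  record Path (u w : V) : Set where
    field
      pathEdges : List E
      connects  : Connects u pathEdges w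
      simple    : Unique (u ∷ map tgt pathEdges)

module Routing (ℝ : RealNumbers) (G : Digraph) (s t : Digraph.V G) where
  open RealNumbers ℝ
  open Digraph G
  open Path
  open DecMembership _≟ᵉ_ using (_∈?_)

  outflow inflow : (E → Carrier) → V → Carrier
  outflow f v = ∑ (filter (λ e → src e ≟ᵛ v) edges) f
  inflow  f v = ∑ (filter (λ e → tgt e ≟ᵛ v) edges) f

  record Feasible (q : Carrier) (f : E → Carrier) : Set where
    field
      nonNegative  : ∀ e → 0# ≤ f e
      conservation : ∀ v → v ≢ s → v ≢ t → inflow f v ≈ outflow f v
      source       : outflow f s - inflow f s ≈ q
      sink         : inflow f t - outflow f t ≈ q

  PathFlow : Set
  PathFlow = List (Path G s t × Carrier)

  load : PathFlow → E → Carrier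
  load h e = ∑ (filter (λ px → e ∈? pathEdges (proj₁ px)) h) proj₂

  Decomposes : PathFlow → (E → Carrier) → Set
  Decomposes h f = All (λ px → 0# ≤ proj₂ px) h × (∀ e → f e ≈ load h e)

  module _ (ℓ : E → Carrier → Carrier) where

    cost : (E → Carrier) → Carrier
    cost f = ∑ edges (λ e → f e * ℓ e (f e))

    pathLatency : (E → Carrier) → Path G s t → Carrier
    pathLatency f p = ∑ (pathEdges p) (λ e → ℓ e (f e))

    record UserEquilibrium (q : Carrier) (f : E → Carrier) : Set where
      field
        feasible   : Feasible q f
        pathFlow   : PathFlow
        decomposes : Decomposes pathFlow f
        optimal    : ∀ p x → (p , x) ∈ pathFlow → 0# < x →
                     ∀ p′ → pathLatency f p ≤ pathLatency f p′

module _ (m n : ℕ) where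

  GridVertex : Set
  GridVertex = Fin (ℕ.suc m) × Fin (ℕ.suc n)

  -- inj₁ (i , j) is the edge (i,j) → (i+1,j) and
  -- inj₂ (i , j) is the edge (i,j) → (i,j+1).
  GridEdge : Set
  GridEdge = (Fin m × Fin (ℕ.suc n)) ⊎ (Fin (ℕ.suc m) × Fin n)

  gridSrc gridTgt : GridEdge → GridVertex
  gridSrc (inj₁ (i , j)) = inject₁ i , j
  gridSrc (inj₂ (i , j)) = i , inject₁ j
  gridTgt (inj₁ (i , j)) = fsuc i , j
  gridTgt (inj₂ (i , j)) = i , fsuc j

  _≟ᵍᵛ_ : DecidableEquality GridVertex
  _≟ᵍᵛ_ = Product.≡-dec Fin._≟_ Fin._≟_

  _≟ᵍᵉ_ : DecidableEquality GridEdge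
  _≟ᵍᵉ_ = Sum.≡-dec (Product.≡-dec Fin._≟_ Fin._≟_) (Product.≡-dec Fin._≟_ Fin._≟_)

  gridEdges : List GridEdge
  gridEdges = map inj₁ (cartesianProduct (allFin m) (allFin (ℕ.suc n)))
           ++ map inj₂ (cartesianProduct (allFin (ℕ.suc m)) (allFin n))

  grid : Digraph
  grid = record
    { V = GridVertex ; E = GridEdge ; src = gridSrc ; tgt = gridTgt
    ; edges = gridEdges ; _≟ᵛ_ = _≟ᵍᵛ_ ; _≟ᵉ_ = _≟ᵍᵉ_ }

  record Chord : Set where
    field
      from to     : GridVertex
      from≢to     : from ≢ to
      nonAdjacent : ∀ e → ¬ (gridSrc e ≡ from × gridTgt e ≡ to)
                        × ¬ (gridSrc e ≡ to × gridTgt e ≡ from)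

  -- The chord is the edge `nothing`.
  gridWithChord : Chord → Digraph
  gridWithChord κ = record
    { V     = GridVertex
    ; E     = Maybe GridEdge
    ; src   = maybe gridSrc (Chord.from κ)
    ; tgt   = maybe gridTgt (Chord.to κ)
    ; edges = nothing ∷ map just gridEdges
    ; _≟ᵛ_  = _≟ᵍᵛ_
    ; _≟ᵉ_  = Maybe.≡-dec _≟ᵍᵉ_
    }

module Braess (ℝ : RealNumbers) (m n : ℕ) (a q : RealNumbers.Carrier ℝ) where
  open RealNumbers ℝ

  origin corner : GridVertex m n
  origin = fzero , fzero
  corner = fromℕ m , fromℕ n

  module Old = Routing ℝ (grid m n) origin corner
  module New (κ : Chord m n) = Routing ℝ (gridWithChord m n κ) origin corner

  oldLatency : Carrier → GridEdge m n → Carrier → Carrier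
  oldLatency b _ x = a * x + b

  newLatency : (b c d : Carrier) → Maybe (GridEdge m n) → Carrier → Carrier
  newLatency b c d (just e) x = oldLatency b e x
  newLatency b c d nothing  x = c * x + d

  -- `IsBraessRatio κ b c d r` says that BR(κ; b, c, d) = r, i.e. that r is the
  -- quotient of the two equilibrium costs.  It is a relation because equilibria
  -- are not computed here; they are unique, so it determines r.
  IsBraessRatio : Chord m n → (b c d r : Carrier) → Set
  IsBraessRatio κ b c d r =
    ∃[ f ] ∃[ g ] ( Old.UserEquilibrium (oldLatency b) q f
                  × New.UserEquilibrium κ (newLatency b c d) q g
                  × ¬ (Old.cost (oldLatency b) f ≈ 0#)
                  × r * Old.cost (oldLatency b) f ≈ New.cost κ (newLatency b c d) g)

  CapableOfParadox : Set
  CapableOfParadox =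
    ∃[ κ ] ∃[ b ] ∃[ c ] ∃[ d ] ∃[ r ]
      (0# ≤ b × 0# ≤ c × 0# ≤ d × IsBraessRatio κ b c d r × 1# < r)

  MaximizesBraessRatio : Chord m n → (b c d : Carrier) → Set
  MaximizesBraessRatio κ b c d =
    ∃[ r ] ( IsBraessRatio κ b c d r
           × (∀ κ′ b′ c′ d′ r′ → 0# ≤ b′ → 0# ≤ c′ → 0# ≤ d′ →
              IsBraessRatio κ′ b′ c′ d′ r′ → r′ ≤ r))

{-# OPTIONS --safe #-}
module Submission where

-- Every grid edge from (i , j) raises the level i + j by one.  Tilting the latencies by a multiple
-- δ of the level therefore shifts all path latencies, and with them both equilibrium costs, by the
-- same constant; it lowers b by δ and the latency L of the chord by δ D, where D is the level
-- difference of the chord.  With δ = L / D the chord becomes free under the same equilibrium flows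
-- f (old) and g (new), while both costs drop by the same amount, which raises a ratio above 1
-- unless L = 0.
--
-- It remains to see that b - δ > 0, i.e. L < b D.  Routing f against the latencies of g is no
-- cheaper than g (variational inequality), and 2 f g ≤ f² + g² on each edge turns this into
-- C_new + x (L - b D) ≤ C_old, where x is the flow on the chord.  So the paradox forces
-- x > 0 and L < b D, and L = c x + d = 0 then gives c = d = 0.

open import Defs
import Algebra.Properties.AbelianGroup as AbelianGroupProperties
import Algebra.Properties.Monoid.Mult as Mult
import Algebra.Solver.Ring.NaturalCoefficients.Default as SemiringSolver
open import Data.Empty using (⊥; ⊥-elim)
open import Data.Fin using (toℕ)
import Data.Fin.Properties as Fin
open import Data.List using (List; []; _∷_; map; filter)
open import Data.List.Membership.Propositional using (_∈_)
open import Data.List.Membership.Propositional.Properties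
  using (∈-map⁺; ∈-map⁻; ∈-++⁺ˡ; ∈-++⁺ʳ; ∈-cartesianProduct⁺; ∈-allFin; ∈-filter⁺; ∈-filter⁻)
import Data.List.Properties as List
open import Data.List.Membership.Propositional.Properties.WithK using (unique∧set⇒bag)
open import Data.List.Relation.Binary.BagAndSetEquality using (∼bag⇒↭)
open import Data.List.Relation.Binary.Permutation.Propositional as Perm using (_↭_)
import Data.List.Relation.Unary.All as All
open import Data.List.Relation.Unary.All.Properties using () renaming (map⁺ to All-map⁺)
open import Data.List.Relation.Unary.Any using (here; there)
import Data.List.Relation.Unary.AllPairs as AllPairs
open import Data.List.Relation.Unary.Unique.Propositional using (Unique)
import Data.List.Relation.Unary.Unique.Propositional.Properties as Unique
open import Data.Maybe using (Maybe; just; nothing)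
open import Data.Maybe.Properties using (just-injective)
open import Data.Nat as ℕ using (ℕ)
import Data.Nat.Properties as ℕ
open import Data.Product using (_×_; _,_; proj₁; proj₂; ∃-syntax)
open import Data.Sum using (inj₁; inj₂)
open import Data.Sum.Properties using (inj₁-injective; inj₂-injective)
open import Function using (_∘_; mk⇔)
open import Relation.Binary.Bundles using (Poset)
open import Relation.Binary.PropositionalEquality as ≡ using (_≡_; _≢_)
import Relation.Binary.Reasoning.PartialOrder as PartialOrderReasoning
open import Relation.Binary.Structures using (IsDecTotalOrder)
open import Relation.Nullary using (¬_; Dec; yes; no)
open import Relation.Unary using (Pred; Decidable)

-- Arithmetic in an ordered field.

module OrderedField (ℝ : RealNumbers) where
  open RealNumbers ℝ
  open IsDecTotalOrder isDecTotalOrder public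
    using (antisym; total; isPartialOrder; ≤-respˡ-≈; ≤-respʳ-≈; _≟_)
    renaming (refl to ≤-refl; reflexive to ≤-reflexive; trans to ≤-trans)
  open AbelianGroupProperties +-abelianGroup public
    using () renaming (//-rightDividesˡ to y-x+x≈y)
  open SemiringSolver commutativeSemiring public
    using (solve; _:=_; _:+_; _:*_)

  poset : Poset _ _ _
  poset = record { isPartialOrder = isPartialOrder }

  open PartialOrderReasoning poset public

  <⇒≱ : ∀ {x y} → x < y → ¬ (y ≤ x)
  <⇒≱ (x≤y , x≉y) y≤x = x≉y (antisym x≤y y≤x)

  ≰⇒< : ∀ {x y} → ¬ (x ≤ y) → y < x
  ≰⇒< {x} {y} x≰y with total x y
  ... | inj₁ x≤y = ⊥-elim (x≰y x≤y)
  ... | inj₂ y≤x = y≤x , x≰y ∘ ≤-reflexive ∘ sym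

  +-mono-≤ : ∀ {u v x y} → u ≤ v → x ≤ y → u + x ≤ v + y
  +-mono-≤ {u} {v} {x} {y} u≤v x≤y = begin
    u + x ≤⟨ +-monoʳ-≤ u x≤y ⟩
    u + y ≈⟨ +-comm u y ⟩
    y + u ≤⟨ +-monoʳ-≤ y u≤v ⟩
    y + v ≈⟨ +-comm y v ⟩
    v + y ∎

  +-cancelʳ-≤ : ∀ z {x y} → x + z ≤ y + z → x ≤ y
  +-cancelʳ-≤ z {x} {y} x+z≤y+z = begin
    x           ≈⟨ x+z-z≈x x ⟨
    x + z - z   ≤⟨ +-mono-≤ x+z≤y+z ≤-refl ⟩
    y + z - z   ≈⟨ x+z-z≈x y ⟩
    y           ∎
    where
    x+z-z≈x : ∀ x → x + z - z ≈ x
    x+z-z≈x = AbelianGroupProperties.//-rightDividesʳ +-abelianGroup z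

  +-cancelʳ-≈ : ∀ z {x y} → x + z ≈ y + z → x ≈ y
  +-cancelʳ-≈ z eq = antisym (+-cancelʳ-≤ z (≤-reflexive eq))
                             (+-cancelʳ-≤ z (≤-reflexive (sym eq)))

  +-nonNegative : ∀ {x y} → 0# ≤ x → 0# ≤ y → 0# ≤ x + y
  +-nonNegative 0≤x 0≤y = ≤-respˡ-≈ (+-identityˡ 0#) (+-mono-≤ 0≤x 0≤y)

  ≤⇒0≤- : ∀ {x y} → x ≤ y → 0# ≤ y - x
  ≤⇒0≤- {x} {y} x≤y = begin
    0#    ≈⟨ -‿inverseʳ x ⟨
    x - x ≤⟨ +-mono-≤ x≤y ≤-refl ⟩
    y - x ∎

  *-monoˡ-≤ : ∀ {z x y} → 0# ≤ z → x ≤ y → z * x ≤ z * y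
  *-monoˡ-≤ {z} {x} {y} 0≤z x≤y = begin
    z * x                 ≈⟨ +-identityˡ _ ⟨
    0# + z * x            ≤⟨ +-mono-≤ (*-nonNegative 0≤z (≤⇒0≤- x≤y)) ≤-refl ⟩
    z * (y - x) + z * x   ≈⟨ distribˡ z (y - x) x ⟨
    z * (y - x + x)       ≈⟨ *-congˡ (y-x+x≈y x y) ⟩
    z * y                 ∎

  *-monoʳ-≤ : ∀ {z x y} → 0# ≤ z → x ≤ y → x * z ≤ y * z
  *-monoʳ-≤ {z} {x} {y} 0≤z x≤y = begin
    x * z ≈⟨ *-comm x z ⟩
    z * x ≤⟨ *-monoˡ-≤ 0≤z x≤y ⟩
    z * y ≈⟨ *-comm z y ⟩
    y * z ∎

  *-cancelˡ-≈ : ∀ {z x y} → ¬ (z ≈ 0#) → z * x ≈ z * y → x ≈ y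
  *-cancelˡ-≈ {z} {x} {y} z≉0 zx≈zy with inverse z z≉0
  ... | z⁻¹ , zz⁻¹≈1 = trans (sym (lemma x)) (trans (*-congˡ zx≈zy) (lemma y))
    where
    lemma : ∀ x → z⁻¹ * (z * x) ≈ x
    lemma x = trans (solve 3 (λ i z x → i :* (z :* x) := (z :* i) :* x) refl z⁻¹ z x)
                    (trans (*-congʳ zz⁻¹≈1) (*-identityˡ x))

  *-cancelˡ-≤ : ∀ {z x y} → 0# < z → z * x ≤ z * y → x ≤ y
  *-cancelˡ-≤ {z} {x} {y} (0≤z , 0≉z) zx≤zy with total x y
  ... | inj₁ x≤y = x≤y
  ... | inj₂ y≤x = ≤-reflexive
    (*-cancelˡ-≈ (0≉z ∘ sym) (antisym zx≤zy (*-monoˡ-≤ 0≤z y≤x)))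

  *-cancelˡ-≤0 : ∀ {z x} → 0# < z → z * x ≤ 0# → x ≤ 0#
  *-cancelˡ-≤0 0<z zx≤0 = *-cancelˡ-≤ 0<z (≤-respʳ-≈ (sym (zeroʳ _)) zx≤0)

  *-positive : ∀ {x y} → 0# < x → 0# < y → 0# < x * y
  *-positive 0<x 0<y = ≰⇒< (<⇒≱ 0<y ∘ *-cancelˡ-≤0 0<x)

  square-nonNegative : ∀ x → 0# ≤ x * x
  square-nonNegative x with total 0# x
  ... | inj₁ 0≤x = *-nonNegative 0≤x 0≤x
  ... | inj₂ x≤0 = +-cancelʳ-≤ (- x * x) (begin
    -- For `x ≤ 0` the factor `- x` is nonnegative, so `- x * x ≤ 0`; this product is the additive
    -- inverse of `x * x`.
    0# + - x * x     ≈⟨ +-identityˡ _ ⟩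
    - x * x          ≤⟨ *-monoˡ-≤ 0≤-x x≤0 ⟩
    - x * 0#         ≈⟨ zeroʳ (- x) ⟩
    0#               ≈⟨ zeroˡ x ⟨
    0# * x           ≈⟨ *-congʳ (-‿inverseʳ x) ⟨
    (x - x) * x      ≈⟨ distribʳ x x (- x) ⟩
    x * x + - x * x  ∎)
    where
    0≤-x : 0# ≤ - x
    0≤-x = ≤-respʳ-≈ (+-identityˡ (- x)) (≤⇒0≤- x≤0)

  0<1 : 0# < 1#
  0<1 = ≤-respʳ-≈ (*-identityˡ 1#) (square-nonNegative 1#) , 0≉1

  -- Expands the square of `z = x - y`. Writing `x` as `z + y` keeps the expansion free of
  -- subtraction.
  2xy≤x²+y² : ∀ x y → x * y + x * y ≤ x * x + y * y
  2xy≤x²+y² x y = begin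
    x * y + x * y               ≈⟨ +-identityˡ _ ⟨
    0# + (x * y + x * y)        ≤⟨ +-mono-≤ (square-nonNegative (x - y)) ≤-refl ⟩
    z * z + (x * y + x * y)     ≈⟨ +-cong refl (+-cong xy≈ xy≈) ⟩
    z * z + ((z + y) * y + (z + y) * y)
      ≈⟨ solve 2 (λ z y → z :* z :+ ((z :+ y) :* y :+ (z :+ y) :* y)
                       := (z :+ y) :* (z :+ y) :+ y :* y) refl z y ⟩
    (z + y) * (z + y) + y * y   ≈⟨ +-cong (*-cong z+y≈x z+y≈x) refl ⟩
    x * x + y * y               ∎
    where
    z : Carrier
    z = x - y
    z+y≈x : z + y ≈ x
    z+y≈x = y-x+x≈y y x
    xy≈ : x * y ≈ (z + y) * y
    xy≈ = *-congʳ (sym z+y≈x)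

  quotient : ∀ x {y} → ¬ (y ≈ 0#) → ∃[ z ] z * y ≈ x
  quotient x {y} y≉0 with inverse y y≉0
  ... | y⁻¹ , yy⁻¹≈1 = x * y⁻¹ ,
    trans (solve 3 (λ x y i → x :* i :* y := (y :* i) :* x) refl x y y⁻¹)
          (trans (*-congʳ yy⁻¹≈1) (*-identityˡ x))

  ≤0⇒≈0 : ∀ {x y} → 0# ≤ x → 0# ≤ y → x + y ≤ 0# → x ≈ 0#
  ≤0⇒≈0 {x} {y} 0≤x 0≤y x+y≤0 = antisym (begin
    x       ≈⟨ +-identityʳ x ⟨
    x + 0#  ≤⟨ +-monoʳ-≤ x 0≤y ⟩
    x + y   ≤⟨ x+y≤0 ⟩
    0#      ∎) 0≤x

  excess : ∀ {r} → 1# < r → ∃[ ε ] (0# < ε × r ≈ 1# + ε)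
  excess {r} (1≤r , 1≉r) = r - 1# , (≤⇒0≤- 1≤r , 0≉ε) , r≈1+ε
    where
    r≈1+ε : r ≈ 1# + (r - 1#)
    r≈1+ε = trans (sym (y-x+x≈y 1# r)) (+-comm _ _)
    0≉ε : ¬ (0# ≈ r - 1#)
    0≉ε 0≈ε = 1≉r (sym (trans r≈1+ε (trans (+-congˡ (sym 0≈ε)) (+-identityʳ 1#))))

  ratio-excess : ∀ {r ε} x → r ≈ 1# + ε → r * x ≈ ε * x + x
  ratio-excess {r} {ε} x r≈1+ε = begin-equality
    r * x          ≈⟨ *-congʳ r≈1+ε ⟩
    (1# + ε) * x   ≈⟨ distribʳ x 1# ε ⟩
    1# * x + ε * x ≈⟨ +-congʳ (*-identityˡ x) ⟩
    x + ε * x      ≈⟨ +-comm x _ ⟩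
    ε * x + x      ∎

  -- From `r * (O′ + K) ≈ N ≈ r′ * O′ + K` and `r′ ≤ r` follows `r * K ≤ K`, hence `ε * K ≤ 0#` for
  -- the excess `ε` of `r` over one. Used with `K` the common drop of both equilibrium costs.
  equalDecrease≤0 : ∀ {r r′ N N′ O O′ K} → 1# < r → 0# ≤ O′ → r * O ≈ N → r′ * O′ ≈ N′ →
             N ≈ N′ + K → O ≈ O′ + K → r′ ≤ r → K ≤ 0#
  equalDecrease≤0 {r} {r′} {N} {N′} {O} {O′} {K} 1<r 0≤O′ rO≈N r′O′≈N′ N≈ O≈ r′≤r with excess 1<r
  ... | ε , 0<ε , r≈1+ε = *-cancelˡ-≤0 0<ε (+-cancelʳ-≤ (r * O′ + K) (begin
    ε * K + (r * O′ + K)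
      ≈⟨ solve 3 (λ e p k → e :+ (p :+ k) := p :+ (e :+ k)) refl _ _ _ ⟩
    r * O′ + (ε * K + K)   ≈⟨ +-congˡ (ratio-excess K r≈1+ε) ⟨
    r * O′ + r * K         ≈⟨ distribˡ r O′ K ⟨
    r * (O′ + K)           ≈⟨ *-congˡ O≈ ⟨
    r * O                  ≈⟨ rO≈N ⟩
    N                      ≈⟨ N≈ ⟩
    N′ + K                 ≈⟨ +-congʳ r′O′≈N′ ⟨
    r′ * O′ + K            ≤⟨ +-mono-≤ (*-monoʳ-≤ 0≤O′ r′≤r) ≤-refl ⟩
    r * O′ + K             ≈⟨ +-identityˡ _ ⟨
    0# + (r * O′ + K)      ∎))

  ratio>1⇒N≰O : ∀ {r N O} → 1# < r → 0# ≤ O → ¬ (O ≈ 0#) → r * O ≈ N → ¬ (N ≤ O)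
  ratio>1⇒N≰O {r} {N} {O} 1<r 0≤O O≉0 rO≈N N≤O with excess 1<r
  ... | ε , 0<ε , r≈1+ε = O≉0 (antisym (*-cancelˡ-≤0 0<ε (+-cancelʳ-≤ O (begin
    ε * O + O  ≈⟨ ratio-excess O r≈1+ε ⟨
    r * O      ≈⟨ rO≈N ⟩
    N          ≤⟨ N≤O ⟩
    O          ≈⟨ +-identityˡ O ⟨
    0# + O     ∎))) 0≤O)

-- Finite sums.

module Sums (ℝ : RealNumbers) where
  open RealNumbers ℝ
  open OrderedField ℝ

  -- Turns filtered sums into weighted sums over the whole list, whose order of summation can be
  -- exchanged.
  indicator : ∀ {P : Set} → Dec P → Carrier
  indicator (yes _) = 1#
  indicator (no _)  = 0#

  module _ {A : Set} where

    ∑-cong : ∀ (xs : List A) {f g : A → Carrier} → (∀ x → f x ≈ g x) → ∑ xs f ≈ ∑ xs g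
    ∑-cong []       f≈g = refl
    ∑-cong (x ∷ xs) f≈g = +-cong (f≈g x) (∑-cong xs f≈g)

    ∑-mono-∈ : ∀ (xs : List A) {f g : A → Carrier} → (∀ {x} → x ∈ xs → f x ≤ g x) → ∑ xs f ≤ ∑ xs g
    ∑-mono-∈ []       f≤g = ≤-refl
    ∑-mono-∈ (x ∷ xs) f≤g = +-mono-≤ (f≤g (here ≡.refl)) (∑-mono-∈ xs (f≤g ∘ there))

    ∑-+ : ∀ (xs : List A) (f g : A → Carrier) → ∑ xs (λ x → f x + g x) ≈ ∑ xs f + ∑ xs g
    ∑-+ []       f g = sym (+-identityˡ 0#)
    ∑-+ (x ∷ xs) f g = trans (+-congˡ (∑-+ xs f g))
      (solve 4 (λ a b c d → (a :+ b) :+ (c :+ d) := (a :+ c) :+ (b :+ d)) refl _ _ _ _)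

    ∑-*ˡ : ∀ (xs : List A) c (f : A → Carrier) → ∑ xs (λ x → c * f x) ≈ c * ∑ xs f
    ∑-*ˡ []       c f = sym (zeroʳ c)
    ∑-*ˡ (x ∷ xs) c f = trans (+-congˡ (∑-*ˡ xs c f)) (sym (distribˡ c _ _))

    ∑-*ʳ : ∀ (xs : List A) c (f : A → Carrier) → ∑ xs (λ x → f x * c) ≈ ∑ xs f * c
    ∑-*ʳ []       c f = sym (zeroˡ c)
    ∑-*ʳ (x ∷ xs) c f = trans (+-congˡ (∑-*ʳ xs c f)) (sym (distribʳ c _ _))

    ∑-0 : ∀ (xs : List A) → ∑ xs (λ _ → 0#) ≈ 0#
    ∑-0 []       = refl
    ∑-0 (x ∷ xs) = trans (+-identityˡ _) (∑-0 xs)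

    ∑-nonNegative : ∀ (xs : List A) {f : A → Carrier} → (∀ x → 0# ≤ f x) → 0# ≤ ∑ xs f
    ∑-nonNegative []       0≤f = ≤-refl
    ∑-nonNegative (x ∷ xs) 0≤f = +-nonNegative (0≤f x) (∑-nonNegative xs 0≤f)

    ∑-↭ : ∀ {xs ys : List A} (f : A → Carrier) → xs ↭ ys → ∑ xs f ≈ ∑ ys f
    ∑-↭ f Perm.refl          = refl
    ∑-↭ f (Perm.prep x p)    = +-congˡ (∑-↭ f p)
    ∑-↭ f (Perm.swap x y p)  = trans (+-congˡ (+-congˡ (∑-↭ f p)))
      (solve 3 (λ a b c → a :+ (b :+ c) := b :+ (a :+ c)) refl _ _ _)
    ∑-↭ f (Perm.trans p p′)  = trans (∑-↭ f p) (∑-↭ f p′)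

    ∑-filter : ∀ {P : Pred A _} (P? : Decidable P) (xs : List A) (f : A → Carrier) →
               ∑ (filter P? xs) f ≈ ∑ xs (λ x → f x * indicator (P? x))
    ∑-filter P? []       f = refl
    ∑-filter P? (x ∷ xs) f with P? x
    ... | yes _ = +-cong (sym (*-identityʳ (f x))) (∑-filter P? xs f)
    ... | no _  = trans (∑-filter P? xs f)
                        (trans (sym (+-identityˡ _)) (+-congʳ (sym (zeroʳ (f x)))))

  ∑-map : ∀ {A B : Set} (g : A → B) (xs : List A) (f : B → Carrier) →
          ∑ (map g xs) f ≡ ∑ xs (f ∘ g)
  ∑-map g []       f = ≡.refl
  ∑-map g (x ∷ xs) f = ≡.cong (f (g x) +_) (∑-map g xs f)

  ∑-swap : ∀ {A B : Set} (xs : List A) (ys : List B) (f : A → B → Carrier) →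
           ∑ xs (λ x → ∑ ys (f x)) ≈ ∑ ys (λ y → ∑ xs (λ x → f x y))
  ∑-swap []       ys f = sym (∑-0 ys)
  ∑-swap (x ∷ xs) ys f = trans (+-congˡ (∑-swap xs ys f)) (sym (∑-+ ys (f x) _))

-- Path decompositions, vertex potentials and equilibria in a general digraph.

module Flows (ℝ : RealNumbers) (G : Digraph) (s t : Digraph.V G)
  (edges-unique : Unique (Digraph.edges G)) (∈-edges : ∀ e → e ∈ Digraph.edges G)
  (s≢t : s ≢ t) where
  open RealNumbers ℝ
  open OrderedField ℝ
  open Sums ℝ
  open Digraph G
  open Routing ℝ G s t
  open Path
  open import Data.List.Membership.DecPropositional _≟ᵉ_ using (_∈?_)

  value : PathFlow → Carrier
  value h = ∑ h proj₂

  pathWeight : (E → Carrier) → Path G s t → Carrier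
  pathWeight w p = ∑ (pathEdges p) w

  -- The differences `ψ (tgt e) - ψ (src e)` telescope along the walk.
  connects-shift : ∀ {w w′ : E → Carrier} (ψ : V → Carrier) →
    (∀ e → w e + ψ (src e) ≈ w′ e + ψ (tgt e)) →
    ∀ {u v} es → Connects G u es v → ∑ es w + ψ u ≈ ∑ es w′ + ψ v
  connects-shift ψ shift []       ≡.refl = refl
  connects-shift {w} {w′} ψ shift {v = v} (e ∷ es) (≡.refl , es-connects) = begin-equality
    w e + ∑ es w + ψ (src e)
      ≈⟨ solve 3 (λ a b c → a :+ b :+ c := (a :+ c) :+ b) refl _ _ _ ⟩
    (w e + ψ (src e)) + ∑ es w
      ≈⟨ +-congʳ (shift e) ⟩
    (w′ e + ψ (tgt e)) + ∑ es w
      ≈⟨ solve 3 (λ a b c → (a :+ b) :+ c := a :+ (c :+ b)) refl _ _ _ ⟩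
    w′ e + (∑ es w + ψ (tgt e))
      ≈⟨ +-congˡ (connects-shift ψ shift es es-connects) ⟩
    w′ e + (∑ es w′ + ψ v)
      ≈⟨ +-assoc _ _ _ ⟨
    w′ e + ∑ es w′ + ψ v ∎

  pathWeight-shift : ∀ {w w′ : E → Carrier} (ψ : V → Carrier) →
    (∀ e → w e + ψ (src e) ≈ w′ e + ψ (tgt e)) →
    ∀ p → pathWeight w p + ψ s ≈ pathWeight w′ p + ψ t
  pathWeight-shift ψ shift p = connects-shift ψ shift (pathEdges p) (connects p)

  -- Two duplicate-free lists with the same elements are permutations of each other. A simple path
  -- repeats no edge, because its edges have distinct targets.
  filter-∈?-pathEdges : ∀ (p : Path G s t) → filter (_∈? pathEdges p) edges ↭ pathEdges p
  filter-∈?-pathEdges p = ∼bag⇒↭ (unique∧set⇒bag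
    (Unique.filter⁺ (_∈? pathEdges p) edges-unique)
    (Unique.map⁻ (AllPairs.tail (simple p)))
    (mk⇔ (proj₂ ∘ ∈-filter⁻ (_∈? pathEdges p) {xs = edges})
         (∈-filter⁺ (_∈? pathEdges p) (∈-edges _))))

  -- Exchanges the sum over edges with the sum over paths. This lets statements about edge flows be
  -- checked path by path.
  ∑-decomposed : ∀ {h f} → Decomposes h f → ∀ w →
    ∑ edges (λ e → f e * w e) ≈ ∑ h (λ px → proj₂ px * pathWeight w (proj₁ px))
  ∑-decomposed {h} {f} (_ , f≈load) w = begin-equality
    ∑ edges (λ e → f e * w e)
      ≈⟨ ∑-cong edges (λ e → *-congʳ (trans (f≈load e) (∑-filter _ h proj₂))) ⟩
    ∑ edges (λ e → ∑ h (λ px → proj₂ px * [ e ∈ px ]) * w e)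
      ≈⟨ ∑-cong edges (λ e → ∑-*ʳ h (w e) _) ⟨
    ∑ edges (λ e → ∑ h (λ px → proj₂ px * [ e ∈ px ] * w e))
      ≈⟨ ∑-swap edges h _ ⟩
    ∑ h (λ px → ∑ edges (λ e → proj₂ px * [ e ∈ px ] * w e))
      ≈⟨ ∑-cong h (λ px → trans
           (∑-cong edges (λ e → solve 3 (λ x i w → x :* i :* w := x :* (w :* i)) refl _ _ _))
           (∑-*ˡ edges (proj₂ px) _)) ⟩
    ∑ h (λ px → proj₂ px * ∑ edges (λ e → w e * [ e ∈ px ]))
      ≈⟨ ∑-cong h (λ px → *-congˡ (∑-filter (_∈? pathEdges (proj₁ px)) edges w)) ⟨
    ∑ h (λ px → proj₂ px * ∑ (filter (_∈? pathEdges (proj₁ px)) edges) w)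
      ≈⟨ ∑-cong h (λ px → *-congˡ (∑-↭ w (filter-∈?-pathEdges (proj₁ px)))) ⟩
    ∑ h (λ px → proj₂ px * pathWeight w (proj₁ px)) ∎
    where
    [_∈_] : E → Path G s t × Carrier → Carrier
    [ e ∈ px ] = indicator (e ∈? pathEdges (proj₁ px))

  value-shift : ∀ {h f} → Decomposes h f → ∀ {w w′ : E → Carrier} (ψ : V → Carrier) →
    (∀ e → w e + ψ (src e) ≈ w′ e + ψ (tgt e)) →
    ∑ edges (λ e → f e * w e) + value h * ψ s ≈ ∑ edges (λ e → f e * w′ e) + value h * ψ t
  value-shift {h} {f} h-f {w} {w′} ψ shift = begin-equality
    ∑ edges (λ e → f e * w e) + value h * ψ s
      ≈⟨ expand w s ⟩
    ∑ h (λ px → proj₂ px * (pathWeight w (proj₁ px) + ψ s))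
      ≈⟨ ∑-cong h (λ px → *-congˡ (pathWeight-shift ψ shift (proj₁ px))) ⟩
    ∑ h (λ px → proj₂ px * (pathWeight w′ (proj₁ px) + ψ t))
      ≈⟨ expand w′ t ⟨
    ∑ edges (λ e → f e * w′ e) + value h * ψ t ∎
    where
    expand : ∀ w v → ∑ edges (λ e → f e * w e) + value h * ψ v
                   ≈ ∑ h (λ px → proj₂ px * (pathWeight w (proj₁ px) + ψ v))
    expand w v = begin-equality
      ∑ edges (λ e → f e * w e) + value h * ψ v
        ≈⟨ +-cong (∑-decomposed h-f w) (sym (∑-*ʳ h (ψ v) proj₂)) ⟩
      ∑ h (λ px → proj₂ px * pathWeight w (proj₁ px)) + ∑ h (λ px → proj₂ px * ψ v)
        ≈⟨ ∑-+ h _ _ ⟨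
      ∑ h (λ px → proj₂ px * pathWeight w (proj₁ px) + proj₂ px * ψ v)
        ≈⟨ ∑-cong h (λ px → distribˡ _ _ _) ⟨
      ∑ h (λ px → proj₂ px * (pathWeight w (proj₁ px) + ψ v)) ∎

  -- Apply `value-shift` to the indicator `δ` of the source, with edge weights `δ (tgt e)` and
  -- `δ (src e)`: the two edge sums are then the inflow and outflow at `s`.
  value≈demand : ∀ {h f q} → Feasible q f → Decomposes h f → value h ≈ q
  value≈demand {h} {f} {q} feasible h-f = +-cancelʳ-≈ (inflow f s) (begin-equality
    value h + inflow f s
      ≈⟨ +-cong (trans (sym (*-identityʳ _)) (*-congˡ (sym δs≈1))) (∑-filter _ edges f) ⟩
    value h * δ s + ∑ edges (λ e → f e * δ (tgt e))
      ≈⟨ +-comm _ _ ⟩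
    ∑ edges (λ e → f e * δ (tgt e)) + value h * δ s
      ≈⟨ value-shift h-f δ (λ e → +-comm _ _) ⟩
    ∑ edges (λ e → f e * δ (src e)) + value h * δ t
      ≈⟨ +-cong (sym (∑-filter _ edges f)) (trans (*-congˡ δt≈0) (zeroʳ _)) ⟩
    outflow f s + 0#
      ≈⟨ +-identityʳ _ ⟩
    outflow f s
      ≈⟨ y-x+x≈y _ _ ⟨
    (outflow f s - inflow f s) + inflow f s
      ≈⟨ +-congʳ (Feasible.source feasible) ⟩
    q + inflow f s ∎)
    where
    δ : V → Carrier
    δ v = indicator (v ≟ᵛ s)

    δs≈1 : δ s ≈ 1#
    δs≈1 with s ≟ᵛ s
    ... | yes _ = refl
    ... | no s≢s = ⊥-elim (s≢s ≡.refl)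

    δt≈0 : δ t ≈ 0#
    δt≈0 with t ≟ᵛ s
    ... | yes t≡s = ⊥-elim (s≢t (≡.sym t≡s))
    ... | no _ = refl

  -- The change `q * ψ t` does not depend on the flow, which is why the old and new equilibrium
  -- costs will drop by the same amount.
  demand-shift : ∀ {h f q} → Feasible q f → Decomposes h f →
    ∀ {w w′ : E → Carrier} (ψ : V → Carrier) → ψ s ≈ 0# →
    (∀ e → w e + ψ (src e) ≈ w′ e + ψ (tgt e)) →
    ∑ edges (λ e → f e * w e) ≈ ∑ edges (λ e → f e * w′ e) + q * ψ t
  demand-shift {h} {f} {q} feasible h-f {w} {w′} ψ ψs≈0 shift = begin-equality
    ∑ edges (λ e → f e * w e)
      ≈⟨ trans (+-congˡ (trans (*-congˡ ψs≈0) (zeroʳ _))) (+-identityʳ _) ⟨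
    ∑ edges (λ e → f e * w e) + value h * ψ s
      ≈⟨ value-shift h-f ψ shift ⟩
    ∑ edges (λ e → f e * w′ e) + value h * ψ t
      ≈⟨ +-congˡ (*-congʳ (value≈demand feasible h-f)) ⟩
    ∑ edges (λ e → f e * w′ e) + q * ψ t ∎

  module _ {ℓ : E → Carrier → Carrier} {q f} (f-ue : UserEquilibrium ℓ q f) where
    open UserEquilibrium f-ue

    -- The cost is the sum of the path latencies weighted by path flows of total `q`, and no used
    -- path is slower than `p`.
    cost≤demand*pathLatency : ∀ p → cost ℓ f ≤ q * pathLatency ℓ f p
    cost≤demand*pathLatency p′ = begin
      cost ℓ f
        ≈⟨ ∑-decomposed decomposes _ ⟩
      ∑ pathFlow (λ px → proj₂ px * pathLatency ℓ f (proj₁ px))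
        ≤⟨ ∑-mono-∈ pathFlow used≤ ⟩
      ∑ pathFlow (λ px → proj₂ px * pathLatency ℓ f p′)
        ≈⟨ ∑-*ʳ pathFlow _ proj₂ ⟩
      value pathFlow * pathLatency ℓ f p′
        ≈⟨ *-congʳ (value≈demand feasible decomposes) ⟩
      q * pathLatency ℓ f p′ ∎
      where
      used≤ : ∀ {px} → px ∈ pathFlow →
              proj₂ px * pathLatency ℓ f (proj₁ px) ≤ proj₂ px * pathLatency ℓ f p′
      used≤ {p , x} px∈ with 0# ≟ x
      -- Optimality says nothing about a path without flow, but such a path contributes zero on both
      -- sides.
      ... | yes 0≈x = ≤-reflexive (trans (vanishes _) (sym (vanishes _)))
        where
        vanishes : ∀ y → x * y ≈ 0#
        vanishes y = trans (*-congʳ (sym 0≈x)) (zeroˡ y)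
      ... | no 0≉x = *-monoˡ-≤ 0≤x (optimal p x px∈ (0≤x , 0≉x) p′)
        where
        0≤x : 0# ≤ x
        0≤x = All.lookup (proj₁ decomposes) px∈

    -- All paths from `s` to `t` change their latency by the same constant, so their comparison is
    -- unaffected. The latency functions need to be related only at the loads of `f`.
    userEquilibrium-shift : ∀ {ℓ′ : E → Carrier → Carrier} (ψ : V → Carrier) →
      (∀ e → ℓ e (f e) + ψ (src e) ≈ ℓ′ e (f e) + ψ (tgt e)) → UserEquilibrium ℓ′ q f
    userEquilibrium-shift {ℓ′} ψ shift = record
      { feasible   = feasible
      ; pathFlow   = pathFlow
      ; decomposes = decomposes
      ; optimal    = λ p x px∈ 0<x p′ → +-cancelʳ-≤ (ψ t) (begin
          pathLatency ℓ′ f p + ψ t   ≈⟨ latency-shift p ⟨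
          pathLatency ℓ f p + ψ s    ≤⟨ +-mono-≤ (optimal p x px∈ 0<x p′) ≤-refl ⟩
          pathLatency ℓ f p′ + ψ s   ≈⟨ latency-shift p′ ⟩
          pathLatency ℓ′ f p′ + ψ t  ∎)
      }
      where
      latency-shift : ∀ p → pathLatency ℓ f p + ψ s ≈ pathLatency ℓ′ f p + ψ t
      latency-shift = pathWeight-shift ψ shift

-- Edge lists and paths of the grid with and without the chord.

module _ (m n : ℕ) where

  gridEdges-unique : Unique (gridEdges m n)
  gridEdges-unique = Unique.++⁺
    (Unique.map⁺ inj₁-injective (Unique.cartesianProduct⁺ (Unique.allFin⁺ m) (Unique.allFin⁺ (ℕ.suc n))))
    (Unique.map⁺ inj₂-injective (Unique.cartesianProduct⁺ (Unique.allFin⁺ (ℕ.suc m)) (Unique.allFin⁺ n)))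
    λ { (∈₁ , ∈₂) → inj₁≢inj₂ (∈-map⁻ inj₁ ∈₁) (∈-map⁻ inj₂ ∈₂) }
    where
    inj₁≢inj₂ : ∀ {A B : Set} {P : A → Set} {Q : B → Set} {v : _} →
             ∃[ x ] (P x × v ≡ inj₁ x) → ∃[ y ] (Q y × v ≡ inj₂ y) → ⊥
    inj₁≢inj₂ (_ , _ , ≡.refl) (_ , _ , ())

  ∈-gridEdges : ∀ e → e ∈ gridEdges m n
  ∈-gridEdges (inj₁ (i , j)) =
    ∈-++⁺ˡ (∈-map⁺ inj₁ (∈-cartesianProduct⁺ (∈-allFin i) (∈-allFin j)))
  ∈-gridEdges (inj₂ (i , j)) =
    ∈-++⁺ʳ _ (∈-map⁺ inj₂ (∈-cartesianProduct⁺ (∈-allFin i) (∈-allFin j)))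

  chordEdges-unique : ∀ κ → Unique (Digraph.edges (gridWithChord m n κ))
  chordEdges-unique κ =
    All-map⁺ (All.tabulate (λ _ ())) AllPairs.∷ Unique.map⁺ just-injective gridEdges-unique

  ∈-chordEdges : ∀ κ e → e ∈ Digraph.edges (gridWithChord m n κ)
  ∈-chordEdges κ (just e) = there (∈-map⁺ just (∈-gridEdges e))
  ∈-chordEdges κ nothing  = here ≡.refl

  module _ (κ : Chord m n) where

    connects-just : ∀ {u w} es → Connects (grid m n) u es w →
                    Connects (gridWithChord m n κ) u (map just es) w
    connects-just []       u≡w              = u≡w
    connects-just (e ∷ es) (e-src , es-con) = e-src , connects-just es es-con

    includePath : ∀ {u w} → Path (grid m n) u w → Path (gridWithChord m n κ) u w
    includePath {u} p = record
      { pathEdges = map just pathEdges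
      ; connects  = connects-just pathEdges connects
      ; simple    = ≡.subst (λ vs → Unique (u ∷ vs)) (List.map-∘ pathEdges) simple
      }
      where open Path p

-- The level potential and the tilting of latencies.

module BraessGrid (ℝ : RealNumbers) (m n : ℕ) (1≤m : 1 ℕ.≤ m)
  (a q : RealNumbers.Carrier ℝ)
  (0<a : RealNumbers._<_ ℝ (RealNumbers.0# ℝ) a)
  (0<q : RealNumbers._<_ ℝ (RealNumbers.0# ℝ) q) where
  open RealNumbers ℝ
  open OrderedField ℝ
  open Sums ℝ
  open Braess ℝ m n a q
  open Mult +-monoid using () renaming (_×_ to _×ₙ_)

  origin≢corner : origin ≢ corner
  origin≢corner eq = ℕ.<⇒≢ 1≤m (≡.trans (≡.cong (toℕ ∘ proj₁) eq) (Fin.toℕ-fromℕ m))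

  module OldFlows = Flows ℝ (grid m n) origin corner
    (gridEdges-unique m n) (∈-gridEdges m n) origin≢corner
  module NewFlows (κ : Chord m n) = Flows ℝ (gridWithChord m n κ) origin corner
    (chordEdges-unique m n κ) (∈-chordEdges m n κ) origin≢corner

  level : GridVertex m n → Carrier
  level (i , j) = (toℕ i ℕ.+ toℕ j) ×ₙ 1#

  level-tgt : ∀ e → level (gridTgt m n e) ≈ 1# + level (gridSrc m n e)
  level-tgt (inj₁ (i , j)) = reflexive
    (≡.cong (λ k → ℕ.suc (k ℕ.+ toℕ j) ×ₙ 1#) (≡.sym (Fin.toℕ-inject₁ i)))
  level-tgt (inj₂ (i , j)) = reflexive (≡.cong (_×ₙ 1#)
    (≡.trans (ℕ.+-suc (toℕ i) (toℕ j))
             (≡.cong (λ k → ℕ.suc (toℕ i ℕ.+ k)) (≡.sym (Fin.toℕ-inject₁ j)))))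

  ×ₙ-nonNegative : ∀ k → 0# ≤ k ×ₙ 1#
  ×ₙ-nonNegative ℕ.zero    = ≤-refl
  ×ₙ-nonNegative (ℕ.suc k) = +-nonNegative (proj₁ 0<1) (×ₙ-nonNegative k)

  ×ₙ-positive : ∀ {k} → 1 ℕ.≤ k → 0# < k ×ₙ 1#
  ×ₙ-positive (ℕ.s≤s {n = k} _) = begin-strict
    0#             <⟨ 0<1 ⟩
    1#             ≈⟨ +-identityʳ 1# ⟨
    1# + 0#        ≤⟨ +-monoʳ-≤ 1# (×ₙ-nonNegative k) ⟩
    1# + k ×ₙ 1#   ∎

  depth : Carrier
  depth = level corner

  0<depth : 0# < depth
  0<depth = ×ₙ-positive (ℕ.≤-trans (≡.subst (1 ℕ.≤_) (≡.sym (Fin.toℕ-fromℕ m)) 1≤m) (ℕ.m≤m+n _ _))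

  -- A grid edge climbs exactly one level, so the potential `β * level` accounts for lowering its
  -- weight by `β`.
  grid-tilt : ∀ {u w} β e → u ≈ w + β →
              u + β * level (gridSrc m n e) ≈ w + β * level (gridTgt m n e)
  grid-tilt {u} {w} β e u≈w+β = sym (begin-equality
    w + β * level (gridTgt m n e)          ≈⟨ +-congˡ (*-congˡ (level-tgt e)) ⟩
    w + β * (1# + level (gridSrc m n e))   ≈⟨ +-congˡ (distribˡ β 1# _) ⟩
    w + (β * 1# + β * level (gridSrc m n e)) ≈⟨ +-congˡ (+-congʳ (*-identityʳ β)) ⟩
    w + (β + β * level (gridSrc m n e))    ≈⟨ +-assoc w β _ ⟨
    (w + β) + β * level (gridSrc m n e)    ≈⟨ +-congʳ u≈w+β ⟨
    u + β * level (gridSrc m n e)          ∎)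

  old-tilt : ∀ {h f} → Old.Feasible q f → Old.Decomposes h f →
    ∀ {w w′ : GridEdge m n → Carrier} β → (∀ e → w e ≈ w′ e + β) →
    ∑ (gridEdges m n) (λ e → f e * w e) ≈ ∑ (gridEdges m n) (λ e → f e * w′ e) + q * (β * depth)
  old-tilt feasible h-f β w≈ =
    OldFlows.demand-shift feasible h-f (λ v → β * level v) (zeroʳ β) (λ e → grid-tilt β e (w≈ e))

  oldCost-nonNegative : ∀ {b f} → 0# ≤ b → (∀ e → 0# ≤ f e) → 0# ≤ Old.cost (oldLatency b) f
  oldCost-nonNegative 0≤b 0≤f = ∑-nonNegative (gridEdges m n) (λ e →
    *-nonNegative (0≤f e) (+-nonNegative (*-nonNegative (proj₁ 0<a) (0≤f e)) 0≤b))

  -- Tilting by `b` splits the cost into the nonnegative sum of `a f²` and the positive constant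
  -- `q * (b * depth)`.
  oldCost-positive : ∀ {b f} → 0# < b → Old.UserEquilibrium (oldLatency b) q f →
                     0# < Old.cost (oldLatency b) f
  oldCost-positive {b} {f} 0<b f-ue = begin-strict
    0#
      <⟨ *-positive 0<q (*-positive 0<b 0<depth) ⟩
    q * (b * depth)
      ≈⟨ +-identityˡ _ ⟨
    0# + q * (b * depth)
      ≤⟨ +-mono-≤ (∑-nonNegative (gridEdges m n) (λ e →
           *-nonNegative (0≤f e) (*-nonNegative (proj₁ 0<a) (0≤f e)))) ≤-refl ⟩
    ∑ (gridEdges m n) (λ e → f e * (a * f e)) + q * (b * depth)
      ≈⟨ old-tilt feasible decomposes b (λ e → refl) ⟨
    Old.cost (oldLatency b) f ∎
    where
    open Old.UserEquilibrium f-ue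
    0≤f : ∀ e → 0# ≤ f e
    0≤f = Old.Feasible.nonNegative feasible

  module _ (κ : Chord m n) where
    open Chord κ

    -- The signed number of levels that the chord climbs. It may be zero or negative, since a chord
    -- can point in any direction.
    bypass : Carrier
    bypass = level to - level from

    new-tilt-edges : ∀ {w w′ : Maybe (GridEdge m n) → Carrier} β → (∀ e → w (just e) ≈ w′ (just e) + β) →
      w nothing ≈ w′ nothing + β * bypass →
      ∀ e → w e + β * level (Digraph.src (gridWithChord m n κ) e)
          ≈ w′ e + β * level (Digraph.tgt (gridWithChord m n κ) e)
    new-tilt-edges β grid chord (just e) = grid-tilt β e (grid e)
    new-tilt-edges {w} {w′} β grid chord nothing = begin-equality
      w nothing + β * level from
        ≈⟨ +-congʳ chord ⟩
      w′ nothing + β * bypass + β * level from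
        ≈⟨ solve 4 (λ w β d l → w :+ β :* d :+ β :* l := w :+ β :* (d :+ l)) refl _ _ _ _ ⟩
      w′ nothing + β * (bypass + level from)
        ≈⟨ +-congˡ (*-congˡ (y-x+x≈y (level from) (level to))) ⟩
      w′ nothing + β * level to ∎

    new-tilt : ∀ {h g} → New.Feasible κ q g → New.Decomposes κ h g →
      ∀ {w w′ : Maybe (GridEdge m n) → Carrier} β → (∀ e → w (just e) ≈ w′ (just e) + β) →
      w nothing ≈ w′ nothing + β * bypass →
      ∑ (Digraph.edges (gridWithChord m n κ)) (λ e → g e * w e) ≈
      ∑ (Digraph.edges (gridWithChord m n κ)) (λ e → g e * w′ e) + q * (β * depth)
    new-tilt feasible h-g β grid chord =
      NewFlows.demand-shift κ feasible h-g (λ v → β * level v) (zeroʳ β) (new-tilt-edges β grid chord)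

    -- Comparison of the two equilibrium costs.

    module _ {b c d f g} (f-ue : Old.UserEquilibrium (oldLatency b) q f)
      (g-ue : New.UserEquilibrium κ (newLatency b c d) q g) where
      private
        module F = Old.UserEquilibrium f-ue
        module G = New.UserEquilibrium κ g-ue
        newCost oldCost : Carrier
        newCost = New.cost κ (newLatency b c d) g
        oldCost = Old.cost (oldLatency b) f

      -- The variational inequality for `g`, tested with `f`. Each path used by `f` is also a path
      -- of the enlarged network, so `newCost` is at most `q` times its latency under `g`. Averaging
      -- over the path flows of `f`, of total `q`, gives the claim multiplied by `q`.
      newCost≤crossCost :
        newCost ≤ ∑ (gridEdges m n) (λ e → f e * oldLatency b e (g (just e)))
      newCost≤crossCost = *-cancelˡ-≤ 0<q (begin
        q * newCost
          ≈⟨ *-congʳ (OldFlows.value≈demand F.feasible F.decomposes) ⟨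
        OldFlows.value F.pathFlow * newCost
          ≈⟨ ∑-*ʳ F.pathFlow newCost proj₂ ⟨
        ∑ F.pathFlow (λ px → proj₂ px * newCost)
          ≤⟨ ∑-mono-∈ F.pathFlow (λ {px} px∈ → *-monoˡ-≤ (All.lookup (proj₁ F.decomposes) px∈)
               (bound (proj₁ px))) ⟩
        ∑ F.pathFlow (λ px → proj₂ px * (q * OldFlows.pathWeight w (proj₁ px)))
          ≈⟨ ∑-cong F.pathFlow (λ px →
               solve 3 (λ x q w → x :* (q :* w) := q :* (x :* w)) refl _ _ _) ⟩
        ∑ F.pathFlow (λ px → q * (proj₂ px * OldFlows.pathWeight w (proj₁ px)))
          ≈⟨ ∑-*ˡ F.pathFlow q _ ⟩
        q * ∑ F.pathFlow (λ px → proj₂ px * OldFlows.pathWeight w (proj₁ px))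
          ≈⟨ *-congˡ (OldFlows.∑-decomposed F.decomposes w) ⟨
        q * ∑ (gridEdges m n) (λ e → f e * w e) ∎)
        where
        w : GridEdge m n → Carrier
        w e = oldLatency b e (g (just e))

        bound : ∀ p → newCost ≤ q * OldFlows.pathWeight w p
        bound p = begin
          newCost
            ≤⟨ NewFlows.cost≤demand*pathLatency κ g-ue (includePath m n κ p) ⟩
          q * New.pathLatency κ (newLatency b c d) g (includePath m n κ p)
            ≈⟨ *-congˡ (reflexive (∑-map just (Path.pathEdges p) _)) ⟩
          q * OldFlows.pathWeight w p ∎

      -- The tilt by b · level turns b into 0 and the latency of the chord into z.
      newCost+chord≤oldCost : ∀ z → c * g nothing + d ≈ z + b * bypass →
                              newCost + g nothing * z ≤ oldCost
      -- Adding `newCost` to both sides produces the doubled cross term `Sfg + Sfg`, which is at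
      -- most `Sff + Sgg`. The terms containing `Sgg` and the chord then reassemble to the added
      -- `newCost`.
      newCost+chord≤oldCost z chord = +-cancelʳ-≤ newCost (begin
        newCost + g nothing * z + newCost
          ≈⟨ solve 2 (λ n y → n :+ y :+ n := (n :+ n) :+ y) refl newCost (g nothing * z) ⟩
        newCost + newCost + g nothing * z
          ≤⟨ +-mono-≤ (+-mono-≤ newCost≤cross newCost≤cross) ≤-refl ⟩
        (Sfg + K) + (Sfg + K) + g nothing * z
          ≈⟨ solve 3 (λ s k y → (s :+ k) :+ (s :+ k) :+ y := (s :+ s) :+ (k :+ k :+ y)) refl _ _ _ ⟩
        (Sfg + Sfg) + (K + K + g nothing * z)
          ≤⟨ +-mono-≤ 2Sfg≤Sff+Sgg ≤-refl ⟩
        (Sff + Sgg) + (K + K + g nothing * z)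
          ≈⟨ solve 4 (λ s t k y → (s :+ t) :+ (k :+ k :+ y) := (s :+ k) :+ ((y :+ t) :+ k)) refl _ _ _ _ ⟩
        (Sff + K) + ((g nothing * z + Sgg) + K)
          ≈⟨ +-cong (old-tilt F.feasible F.decomposes b (λ e → refl)) newCost≈ ⟨
        oldCost + newCost ∎)
        where
        K Sff Sfg Sgg : Carrier
        K   = q * (b * depth)
        Sff = ∑ (gridEdges m n) (λ e → f e * (a * f e))
        Sfg = ∑ (gridEdges m n) (λ e → f e * (a * g (just e)))
        Sgg = ∑ (gridEdges m n) (λ e → g (just e) * (a * g (just e)))

        newCost≤cross : newCost ≤ Sfg + K
        newCost≤cross = ≤-respʳ-≈ (old-tilt F.feasible F.decomposes b (λ e → refl)) newCost≤crossCost

        residual : Maybe (GridEdge m n) → Carrier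
        residual (just e) = a * g (just e)
        residual nothing  = z

        newCost≈ : newCost ≈ (g nothing * z + Sgg) + K
        newCost≈ = trans (new-tilt G.feasible G.decomposes {w′ = residual} b (λ e → refl) chord)
          (+-congʳ (+-congˡ (reflexive (∑-map just (gridEdges m n) _))))

        2Sfg≤Sff+Sgg : Sfg + Sfg ≤ Sff + Sgg
        2Sfg≤Sff+Sgg = begin
          Sfg + Sfg
            ≈⟨ ∑-+ (gridEdges m n) _ _ ⟨
          ∑ (gridEdges m n) (λ e → f e * (a * g (just e)) + f e * (a * g (just e)))
            ≤⟨ ∑-mono-∈ (gridEdges m n) (λ {e} _ → scaled (f e) (g (just e))) ⟩
          ∑ (gridEdges m n) (λ e → f e * (a * f e) + g (just e) * (a * g (just e)))
            ≈⟨ ∑-+ (gridEdges m n) _ _ ⟩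
          Sff + Sgg ∎
          where
          scaled : ∀ x y → x * (a * y) + x * (a * y) ≤ x * (a * x) + y * (a * y)
          scaled x y = begin
            x * (a * y) + x * (a * y)
              ≈⟨ solve 3 (λ x y a → x :* (a :* y) :+ x :* (a :* y) := a :* (x :* y :+ x :* y)) refl x y a ⟩
            a * (x * y + x * y)
              ≤⟨ *-monoˡ-≤ (proj₁ 0<a) (2xy≤x²+y² x y) ⟩
            a * (x * x + y * y)
              ≈⟨ solve 3 (λ x y a → a :* (x :* x :+ y :* y) := x :* (a :* x) :+ y :* (a :* y)) refl x y a ⟩
            x * (a * x) + y * (a * y) ∎

      -- Trading the latency of the chord for a uniform change of the grid latencies.

      module FreeChord {b′ δ} (b≈b′+δ : b ≈ b′ + δ)
        (δ*bypass≈ : δ * bypass ≈ c * g nothing + d) where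

        saving : Carrier
        saving = q * (δ * depth)

        private
          lower : ∀ x → a * x + b ≈ (a * x + b′) + δ
          lower x = trans (+-congˡ b≈b′+δ) (sym (+-assoc _ _ _))

          free : c * g nothing + d ≈ (0# * g nothing + 0#) + δ * bypass
          free = trans (sym δ*bypass≈) (sym (trans
            (+-congʳ (trans (+-identityʳ _) (zeroˡ _))) (+-identityˡ _)))

          tilt : ∀ e → newLatency b c d e (g e) + δ * level (Digraph.src (gridWithChord m n κ) e)
                     ≈ newLatency b′ 0# 0# e (g e) + δ * level (Digraph.tgt (gridWithChord m n κ) e)
          tilt = new-tilt-edges δ (λ e → lower (g (just e))) free

        f-equilibrium : Old.UserEquilibrium (oldLatency b′) q f
        f-equilibrium = OldFlows.userEquilibrium-shift f-ue (λ v → δ * level v)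
          (λ e → grid-tilt δ e (lower (f e)))

        -- The tilt matches the chord latency `c * x + d` with zero only at the load
        -- `x = g nothing`. This suffices, as the equilibrium conditions evaluate latencies only at
        -- `g`.
        g-equilibrium : New.UserEquilibrium κ (newLatency b′ 0# 0#) q g
        g-equilibrium = NewFlows.userEquilibrium-shift κ g-ue (λ v → δ * level v) tilt

        oldCost≈ : oldCost ≈ Old.cost (oldLatency b′) f + saving
        oldCost≈ = old-tilt F.feasible F.decomposes δ (λ e → lower (f e))

        newCost≈ : newCost ≈ New.cost κ (newLatency b′ 0# 0#) g + saving
        newCost≈ = new-tilt G.feasible G.decomposes δ (λ e → lower (g (just e))) free

  -- What a cost increase implies for the chord.

  module Paradox (κ : Chord m n) {b c d f g} (0≤b : 0# ≤ b) (0≤c : 0# ≤ c) (0≤d : 0# ≤ d)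
    (f-ue : Old.UserEquilibrium (oldLatency b) q f)
    (g-ue : New.UserEquilibrium κ (newLatency b c d) q g)
    (N≰O : ¬ (New.cost κ (newLatency b c d) g ≤ Old.cost (oldLatency b) f)) where

    D x L z : Carrier
    D = bypass κ
    x = g nothing
    L = c * x + d
    z = L - b * D

    L≈z+bD : L ≈ z + b * D
    L≈z+bD = sym (y-x+x≈y (b * D) L)

    0≤x : 0# ≤ x
    0≤x = New.Feasible.nonNegative {κ} (New.UserEquilibrium.feasible {κ} g-ue) nothing

    0≤L : 0# ≤ L
    0≤L = +-nonNegative (*-nonNegative 0≤c 0≤x) 0≤d

    -- Otherwise the bound on `newCost + x * z` would make the new cost at most the old one. Both
    -- `x ≉ 0` and `z < 0`, that is `L < b * D`, are read off from this.
    0≰xz : ¬ (0# ≤ x * z)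
    0≰xz 0≤xz = N≰O (begin
      New.cost κ (newLatency b c d) g           ≈⟨ +-identityʳ _ ⟨
      New.cost κ (newLatency b c d) g + 0#      ≤⟨ +-monoʳ-≤ _ 0≤xz ⟩
      New.cost κ (newLatency b c d) g + x * z   ≤⟨ newCost+chord≤oldCost κ f-ue g-ue z L≈z+bD ⟩
      Old.cost (oldLatency b) f                 ∎)

    x≉0 : ¬ (x ≈ 0#)
    x≉0 x≈0 = 0≰xz (≤-reflexive (sym (trans (*-congʳ x≈0) (zeroˡ z))))

    L<bD : L < b * D
    L<bD = ≰⇒< (λ bD≤L → 0≰xz (*-nonNegative 0≤x (≤⇒0≤- bD≤L)))

    -- Since `0 ≤ L < b * D` and `b` is nonnegative, `D` cannot be nonpositive.
    0<D : 0# < D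
    0<D = ≰⇒< (λ D≤0 → <⇒≱ L<bD (begin
      b * D   ≤⟨ *-monoˡ-≤ 0≤b D≤0 ⟩
      b * 0#  ≈⟨ zeroʳ b ⟩
      0#      ≤⟨ 0≤L ⟩
      L       ∎))

    -- `δ` is the quotient `L / D`, the tilt that uses up the whole latency of the chord.
    δ b′ : Carrier
    δ  = proj₁ (quotient L (proj₂ 0<D ∘ sym))
    b′ = b - δ

    δD≈L : δ * D ≈ L
    δD≈L = proj₂ (quotient L (proj₂ 0<D ∘ sym))

    b≈b′+δ : b ≈ b′ + δ
    b≈b′+δ = sym (y-x+x≈y δ b)

    -- If `b ≤ δ`, then `b * D ≤ δ * D ≈ L`, against `L < b * D`. Positivity makes `b′` an
    -- admissible coefficient and the tilted old cost positive.
    0<b′ : 0# < b′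
    0<b′ = ≰⇒< (λ b′≤0 → <⇒≱ L<bD (begin
      b * D         ≤⟨ *-monoʳ-≤ (proj₁ 0<D) (b≤δ b′≤0) ⟩
      δ * D         ≈⟨ δD≈L ⟩
      L             ∎))
      where
      b≤δ : b′ ≤ 0# → b ≤ δ
      b≤δ b′≤0 = begin
        b       ≈⟨ b≈b′+δ ⟩
        b′ + δ  ≤⟨ +-mono-≤ b′≤0 ≤-refl ⟩
        0# + δ  ≈⟨ +-identityˡ δ ⟩
        δ       ∎

    open FreeChord κ f-ue g-ue b≈b′+δ δD≈L public

    -- As `saving` is `q * (δ * depth)` with `q` and `depth` positive, `δ ≤ 0` and so `L ≤ 0`. The
    -- nonnegative summands `c * x` and `d` of `L` then vanish, and `x ≉ 0` gives `c ≈ 0#`.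
    saving≤0⇒free : saving ≤ 0# → c ≈ 0# × d ≈ 0#
    saving≤0⇒free K≤0 =
      *-cancelˡ-≈ x≉0 (trans (*-comm x c) (trans (≤0⇒≈0 0≤cx 0≤d L≤0) (sym (zeroʳ x)))) ,
      ≤0⇒≈0 0≤d 0≤cx (≤-respˡ-≈ (+-comm _ _) L≤0)
      where
      0≤cx : 0# ≤ c * x
      0≤cx = *-nonNegative 0≤c 0≤x

      δ≤0 : δ ≤ 0#
      δ≤0 = *-cancelˡ-≤0 0<depth (≤-respˡ-≈ (*-comm δ depth) (*-cancelˡ-≤0 0<q K≤0))

      L≤0 : L ≤ 0#
      L≤0 = begin
        L       ≈⟨ δD≈L ⟨
        δ * D   ≤⟨ *-monoʳ-≤ (proj₁ 0<D) δ≤0 ⟩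
        0# * D  ≈⟨ zeroˡ D ⟩
        0#      ∎

theorem4p3 : (ℝ : RealNumbers) → let open RealNumbers ℝ in
    (m n : ℕ) → 1 ℕ.≤ m → 1 ℕ.≤ n →
    (a q : Carrier) → 0# < a → 0# < q →
    Braess.CapableOfParadox ℝ m n a q →
    (κ : Chord m n) (b c d : Carrier) → 0# ≤ b → 0# ≤ c → 0# ≤ d →
    Braess.MaximizesBraessRatio ℝ m n a q κ b c d →
    c ≈ 0# × d ≈ 0#
theorem4p3 ℝ m n 1≤m _ a q 0<a 0<q
  (κ₀ , b₀ , c₀ , d₀ , r₀ , 0≤b₀ , 0≤c₀ , 0≤d₀ , isRatio₀ , 1<r₀)
  κ b c d 0≤b 0≤c 0≤d (r , (f , g , f-ue , g-ue , O≉0 , rO≈N) , r-max) =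
  -- The competitor is the same chord with coefficients `b′`, `0#`, `0#` and the same flows `f` and
  -- `g`. Maximality bounds its ratio `r′` by `r`, which leaves no room for a positive saving.
  saving≤0⇒free (equalDecrease≤0 1<r (proj₁ 0<O′) rO≈N r′O′≈N′ newCost≈ oldCost≈
    (r-max κ b′ 0# 0# r′ (proj₁ 0<b′) ≤-refl ≤-refl
      (f , g , f-equilibrium , g-equilibrium , O′≉0 , r′O′≈N′)))
  where
  open RealNumbers ℝ
  open OrderedField ℝ
  open Braess ℝ m n a q
  open BraessGrid ℝ m n 1≤m a q 0<a 0<q

  1<r : 1# < r
  -- The maximal ratio is at least the one that witnesses the paradox.
  1<r = begin-strict
    1# <⟨ 1<r₀ ⟩
    r₀ ≤⟨ r-max κ₀ b₀ c₀ d₀ r₀ 0≤b₀ 0≤c₀ 0≤d₀ isRatio₀ ⟩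
    r  ∎

  open Paradox κ 0≤b 0≤c 0≤d f-ue g-ue
    (ratio>1⇒N≰O 1<r (oldCost-nonNegative 0≤b
      (Old.Feasible.nonNegative (Old.UserEquilibrium.feasible f-ue))) O≉0 rO≈N)

  O′ N′ : Carrier
  O′ = Old.cost (oldLatency b′) f
  N′ = New.cost κ (newLatency b′ 0# 0#) g

  0<O′ : 0# < O′
  0<O′ = oldCost-positive 0<b′ f-equilibrium

  O′≉0 : ¬ (O′ ≈ 0#)
  O′≉0 = proj₂ 0<O′ ∘ sym

  r′ : Carrier
  r′ = proj₁ (quotient N′ O′≉0)

  r′O′≈N′ : r′ * O′ ≈ N′
  r′O′≈N′ = proj₂ (quotient N′ O′≉0)
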